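{- Let $G$ be a maximal $3$-$\gamma_{c}$-vertex critical graph with independence number $\alpha$ and minimum degree $\delta$. Then $\alpha \leq \delta$.
   Context: All graphs are finite, simple and connected. A connected dominating set of $G$ is a set $D \subseteq V(G)$ such that every vertex of $G$ is in $D$ or adjacent to a vertex of $D$, and $G[D]$ is connected; $\gamma_{c}(G)$ is the minimum size of such a set. $G$ is $k$-$\gamma_{c}$-edge critical if $\gamma_{c}(G)=k$ and $\gamma_{c}(G+uv)<k$ for every pair of non-adjacent vertices $u,v$. A $2$-connected graph $G$ is $k$-$\gamma_{c}$-vertex critical if $\gamma_{c}(G)=k$ and $\gamma_{c}(G-v)<k$ for every $v \in V(G)$. $G$ is maximal $k$-$\gamma_{c}$-vertex critical if it is both $k$-$\gamma_{c}$-edge critical and $k$-$\gamma_{c}$-vertex critical. -}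

module Defs where

open import Data.Nat using (ℕ; _≤_; _<_; _≥_)
open import Data.Bool using (Bool; true; false; T; _∨_; _∧_; not)
open import Data.Fin using (Fin)
open import Data.Fin.Properties using (_≟_)
open import Data.Fin.Subset using (Subset; _∈_; _∉_; _⊆_; ∣_∣)
open import Data.Vec using (tabulate)
open import Data.Product using (Σ; ∃; _×_; _,_)
open import Data.Sum using (_⊎_)
open import Data.Unit using (⊤)
open import Relation.Nullary using (¬_)
open import Relation.Nullary.Decidable using (⌊_⌋)
open import Relation.Binary.PropositionalEquality using (_≡_; _≢_)

Adjacency : ℕ → Set
Adjacency n = Fin n → Fin n → Bool

record IsSimple {n : ℕ} (adj : Adjacency n) : Set where
  field
    symmetric   : ∀ u v → adj u v ≡ adj v u
    irreflexive : ∀ v → adj v v ≡ false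

data Walk {n : ℕ} (adj : Adjacency n) (P : Fin n → Set) : Fin n → Fin n → Set where
  nil  : ∀ {u} → P u → Walk adj P u u
  cons : ∀ {u w v} → P u → T (adj u w) → Walk adj P w v → Walk adj P u v

InducedConnected : {n : ℕ} → Adjacency n → (Fin n → Set) → Set
InducedConnected adj P = ∀ u v → P u → P v → Walk adj P u v

-- The whole graph is connected (and nonempty, as graphs have ≥ 1 vertex).
Connected : {n : ℕ} → Adjacency n → Set
Connected {n} adj = (1 ≤ n) × (∀ (u v : Fin n) → Walk adj (λ _ → ⊤) u v)

Minus : {n : ℕ} → Fin n → Fin n → Set
Minus x w = w ≢ x

TwoConnected : {n : ℕ} → Adjacency n → Set
TwoConnected {n} adj =
  (3 ≤ n) × Connected adj × (∀ x → InducedConnected adj (Minus x))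

IsCDSIn : {n : ℕ} → Adjacency n → (Fin n → Set) → Subset n → Set
IsCDSIn adj S D =
  (∀ w → w ∈ D → S w) ×
  (∀ w → S w → w ∈ D ⊎ (∃ λ u → u ∈ D × T (adj u w))) ×
  InducedConnected adj (λ w → w ∈ D)

IsCDS : {n : ℕ} → Adjacency n → Subset n → Set
IsCDS adj D = IsCDSIn adj (λ _ → ⊤) D

ConnDomNumberIs : {n : ℕ} → Adjacency n → ℕ → Set
ConnDomNumberIs adj k =
  (∃ λ D → IsCDS adj D × ∣ D ∣ ≡ k) × (∀ D → IsCDS adj D → k ≤ ∣ D ∣)

addEdge : {n : ℕ} → Adjacency n → Fin n → Fin n → Adjacency n
addEdge adj u v x y =
  adj x y ∨ ((⌊ x ≟ u ⌋ ∧ ⌊ y ≟ v ⌋) ∨ (⌊ x ≟ v ⌋ ∧ ⌊ y ≟ u ⌋))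

EdgeCritical : {n : ℕ} → Adjacency n → ℕ → Set
EdgeCritical adj k =
  ConnDomNumberIs adj k ×
  (∀ u v → u ≢ v → adj u v ≡ false →
     ∃ λ D → IsCDS (addEdge adj u v) D × ∣ D ∣ < k)

-- k-γc-vertex critical (for 2-connected G); γc(G - v) < k means G - v has a
-- connected dominating set of size < k.
VertexCritical : {n : ℕ} → Adjacency n → ℕ → Set
VertexCritical adj k =
  TwoConnected adj × ConnDomNumberIs adj k ×
  (∀ v → ∃ λ D → IsCDSIn adj (Minus v) D × ∣ D ∣ < k)

MaximalVertexCritical : {n : ℕ} → Adjacency n → ℕ → Set
MaximalVertexCritical adj k = EdgeCritical adj k × VertexCritical adj k

IsIndependent : {n : ℕ} → Adjacency n → Subset n → Set
IsIndependent adj I = ∀ u v → u ∈ I → v ∈ I → adj u v ≡ false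

IndependenceNumberIs : {n : ℕ} → Adjacency n → ℕ → Set
IndependenceNumberIs adj a =
  (∃ λ I → IsIndependent adj I × ∣ I ∣ ≡ a) × (∀ I → IsIndependent adj I → ∣ I ∣ ≤ a)

neighbourhood : {n : ℕ} → Adjacency n → Fin n → Subset n
neighbourhood adj v = tabulate (adj v)

degree : {n : ℕ} → Adjacency n → Fin n → ℕ
degree adj v = ∣ neighbourhood adj v ∣

MinDegreeIs : {n : ℕ} → Adjacency n → ℕ → Set
MinDegreeIs adj d = (∃ λ v → degree adj v ≡ d) × (∀ v → d ≤ degree adj v)

{-# OPTIONS --safe #-}
module Submission where

-- Let I be independent with |I| ≥ 3 and v any vertex; the aim is to inject I into N(v).
-- Members of I adjacent to v represent themselves.  For b ≠ b′ in I, edge-criticality gives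
-- a dominating pair of G − b′ of the form {b, y}, or one of G − b of the form {b′, y}.  If v
-- is adjacent to neither b nor b′, this y is a neighbour of v that misses, within I, only b′
-- (resp. b); it can represent that member.  Hence besides v itself at most one member s of I
-- has no representative.
--
-- The representatives still needed come from vertex-criticality.  If y represents b, then a
-- pair dominating G − y contains a neighbour c of v not adjacent to y.  Either c represents
-- nobody, or c represents some b₀.  In that case the pair of G − b₀ or G − b supplied by b, b₀
-- contains a y′ representing b₀ or b; it is not c in the former case, because {b, c} leaves y
-- undominated, and not y in the latter, because {b₀, y} leaves c undominated, so b₀ or b has two
-- representatives.  Either way one neighbour of v is to spare.  If both v and s lack a
-- representative, a second spare neighbour is found in a pair dominating G − s.

open import Defs
open import Data.Bool using (T; _∧_; false)
open import Data.Bool.Properties using (T-≡; T-∧; T-∨; T?)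
open import Data.Fin using (Fin; zero; suc; punchIn)
open import Data.Fin.Properties using (_≟_; any?; all?; punchInᵢ≢i; suc-injective)
open import Data.Fin.Subset using (Subset; inside; outside; _∈_; _∉_; _-_; ∣_∣) renaming (⊤ to full)
open import Data.Fin.Subset.Properties
  using (_∈?_; x∈p⇒∣p-x∣<∣p∣; x∈p∧x≢y⇒x∈p-y; ∈⊤)
open import Data.Nat using (ℕ; _≤_; _<_; z≤n; s≤s; _≤?_)
open import Data.Nat.Properties using (≤-trans; ≤-<-trans; <⇒≱; ≤-pred; ≰⇒>)
open import Data.Product using (∃; ∃₂; _×_; _,_; proj₁)
open import Data.Sum using (_⊎_; inj₁; inj₂)
open import Data.Unit using (⊤; tt)
open import Data.Vec using ([]; _∷_; here; there)
open import Data.Vec.Properties using (lookup⇒[]=; lookup∘tabulate)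
open import Function using (_∘_; case_of_)
open import Function.Bundles using (Equivalence)
open import Relation.Nullary using (¬_; Dec; yes; no; contradiction)
open import Relation.Nullary.Decidable
  using (⌊_⌋; decidable-stable; toWitness; _×-dec_; _→-dec_; _⊎-dec_; ¬?)
open import Relation.Binary.PropositionalEquality

-- Counting by injective relations.

injection⇒∣p∣≤∣q∣ : ∀ {m n} (R : Fin m → Fin n → Set) (p : Subset m) (q : Subset n) →
  (∀ x → x ∈ p → ∃ λ y → y ∈ q × R x y) →
  (∀ {x x′ y} → x ∈ p → x′ ∈ p → R x y → R x′ y → x ≡ x′) →
  ∣ p ∣ ≤ ∣ q ∣
injection⇒∣p∣≤∣q∣ R [] q total inj = z≤n
injection⇒∣p∣≤∣q∣ R (outside ∷ p) q total inj =
  injection⇒∣p∣≤∣q∣ (R ∘ suc) p q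
    (λ x x∈p → total (suc x) (there x∈p))
    (λ x∈p x′∈p r r′ → suc-injective (inj (there x∈p) (there x′∈p) r r′))
injection⇒∣p∣≤∣q∣ R (inside ∷ p) q total inj with total zero here
... | y₀ , y₀∈q , r₀ = ≤-<-trans
  (injection⇒∣p∣≤∣q∣ (R ∘ suc) p (q - y₀) total′
    (λ x∈p x′∈p r r′ → suc-injective (inj (there x∈p) (there x′∈p) r r′)))
  (x∈p⇒∣p-x∣<∣p∣ y₀∈q)
  where
  total′ : ∀ x → x ∈ p → ∃ λ y → y ∈ q - y₀ × R (suc x) y
  total′ x x∈p with total (suc x) (there x∈p)
  ... | y , y∈q , r = y , x∈p∧x≢y⇒x∈p-y y∈q y≢y₀ , r
    where
    y≢y₀ : y ≢ y₀
    y≢y₀ refl = case inj here (there x∈p) r₀ r of λ ()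

-- `c` goes to `s`; all others have an image other than `c`, so the enlarged relation stays
-- injective.
injection-with-spare : ∀ {m n} (R : Fin m → Fin n → Set) (p : Subset m) (q : Subset n) s c →
  c ∈ q →
  (∀ x → x ∈ p → x ≢ s → ∃ λ y → y ∈ q × R x y × y ≢ c) →
  (∀ {x x′ y} → x ∈ p → x′ ∈ p → R x y → R x′ y → x ≡ x′) →
  ∣ p ∣ ≤ ∣ q ∣
injection-with-spare {m} {n} R p q s c c∈q total inj = injection⇒∣p∣≤∣q∣ R′ p q total′ inj′
  where
  R′ : Fin m → Fin n → Set
  R′ x y = (x ≡ s × y ≡ c) ⊎ (R x y × y ≢ c)

  total′ : ∀ x → x ∈ p → ∃ λ y → y ∈ q × R′ x y
  total′ x x∈p with x ≟ s
  ... | yes x≡s = c , c∈q , inj₁ (x≡s , refl)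
  ... | no  x≢s with total x x∈p x≢s
  ...   | y , y∈q , r , y≢c = y , y∈q , inj₂ (r , y≢c)

  inj′ : ∀ {x x′ y} → x ∈ p → x′ ∈ p → R′ x y → R′ x′ y → x ≡ x′
  inj′ _   _    (inj₁ (refl , _)) (inj₁ (refl , _))    = refl
  inj′ _   _    (inj₁ (_ , y≡c))  (inj₂ (_ , y≢c))     = contradiction y≡c y≢c
  inj′ _   _    (inj₂ (_ , y≢c))  (inj₁ (_ , y≡c))     = contradiction y≡c y≢c
  inj′ x∈p x′∈p (inj₂ (r , _))    (inj₂ (r′ , _))      = inj x∈p x′∈p r r′

three-members⇒3≤∣p∣ : ∀ {n} {p : Subset n} {x y z} → x ∈ p → y ∈ p → z ∈ p →
  y ≢ x → z ≢ x → z ≢ y → 3 ≤ ∣ p ∣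
three-members⇒3≤∣p∣ x∈p y∈p z∈p y≢x z≢x z≢y =
  ≤-trans (s≤s (≤-trans (s≤s (≤-trans (s≤s z≤n) (x∈p⇒∣p-x∣<∣p∣ z∈p-x-y))) (x∈p⇒∣p-x∣<∣p∣ y∈p-x)))
    (x∈p⇒∣p-x∣<∣p∣ x∈p)
  where
  y∈p-x = x∈p∧x≢y⇒x∈p-y y∈p y≢x
  z∈p-x-y = x∈p∧x≢y⇒x∈p-y (x∈p∧x≢y⇒x∈p-y z∈p z≢x) z≢y

two-members⇒2≤∣p∣ : ∀ {n} {p : Subset n} {x y} → x ∈ p → y ∈ p → y ≢ x → 2 ≤ ∣ p ∣
two-members⇒2≤∣p∣ x∈p y∈p y≢x =
  ≤-trans (s≤s (≤-trans (s≤s z≤n) (x∈p⇒∣p-x∣<∣p∣ (x∈p∧x≢y⇒x∈p-y y∈p y≢x))))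
    (x∈p⇒∣p-x∣<∣p∣ x∈p)

-- Otherwise `p` would embed into a two-element set of labels for `u` and `w`, which may coincide.
third-member : ∀ {n} {p : Subset n} → 3 ≤ ∣ p ∣ → ∀ u w → ∃ λ t → t ∈ p × t ≢ u × t ≢ w
third-member {n} {p} 3≤∣p∣ u w
  with any? (λ t → (t ∈? p) ×-dec (¬? (t ≟ u) ×-dec ¬? (t ≟ w)))
... | yes t = t
... | no none = contradiction
  (injection⇒∣p∣≤∣q∣ R p full total λ { _ _ (inj₁ (refl , refl)) (inj₁ (refl , refl)) → refl
                                      ; _ _ (inj₂ (refl , refl)) (inj₂ (refl , refl)) → refl })
  (<⇒≱ 3≤∣p∣)
  where
  R : Fin n → Fin 2 → Set
  R x y = (x ≡ u × y ≡ zero) ⊎ (x ≡ w × y ≡ suc zero)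

  total : ∀ x → x ∈ p → ∃ λ y → y ∈ full × R x y
  total x x∈p with x ≟ u | x ≟ w
  ... | yes x≡u | _       = zero , ∈⊤ , inj₁ (x≡u , refl)
  ... | no  _   | yes x≡w = suc zero , ∈⊤ , inj₂ (x≡w , refl)
  ... | no  x≢u | no  x≢w = contradiction (x , x∈p , x≢u , x≢w) none

-- Added edges and walks.

toWitness₂ : ∀ {A B : Set} (a? : Dec A) (b? : Dec B) → T (⌊ a? ⌋ ∧ ⌊ b? ⌋) → A × B
toWitness₂ a? b? t with Equivalence.to (T-∧ {⌊ a? ⌋}) t
... | a , b = toWitness a , toWitness b

addEdge⁻ : ∀ {n} (adj : Adjacency n) u w {x y} → T (addEdge adj u w x y) →
  T (adj x y) ⊎ (x ≡ u × y ≡ w) ⊎ (x ≡ w × y ≡ u)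
addEdge⁻ adj u w {x} {y} t with Equivalence.to (T-∨ {adj x y}) t
... | inj₁ e = inj₁ e
... | inj₂ t′ with Equivalence.to (T-∨ {⌊ x ≟ u ⌋ ∧ ⌊ y ≟ w ⌋}) t′
...   | inj₁ e = inj₂ (inj₁ (toWitness₂ (x ≟ u) (y ≟ w) e))
...   | inj₂ e = inj₂ (inj₂ (toWitness₂ (x ≟ w) (y ≟ u) e))

walk-start : ∀ {n} {adj : Adjacency n} {P u v} → Walk adj P u v → P u
walk-start (nil p)      = p
walk-start (cons p _ _) = p

walk-map : ∀ {n} {adj adj′ : Adjacency n} {P} →
  (∀ {x y} → P x → P y → T (adj x y) → T (adj′ x y)) →
  ∀ {u v} → Walk adj P u v → Walk adj′ P u v
walk-map f (nil p)      = nil p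
walk-map f (cons p e w) = cons p (f p (walk-start w) e) (walk-map f w)

some-neighbour : ∀ {n} {adj : Adjacency n} → 3 ≤ n → (∀ u w → Walk adj (λ _ → ⊤) u w) →
  ∀ v → ∃ λ w → T (adj v w)
some-neighbour {adj = adj} (s≤s (s≤s _)) walk v =
  first-step (walk v (punchIn v zero)) (punchInᵢ≢i v zero ∘ sym)
  where
  first-step : ∀ {w} → Walk adj (λ _ → ⊤) v w → v ≢ w → ∃ λ w → T (adj v w)
  first-step (nil _) v≢v    = contradiction refl v≢v
  first-step (cons _ e _) _ = _ , e

-- Adjacency and dominating pairs.

module Graph {n : ℕ} (adj : Adjacency n) (simple : IsSimple adj) where

  open IsSimple simple

  infix 4 _~_ _≁_

  _~_ _≁_ : Fin n → Fin n → Set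
  x ~ y = T (adj x y)
  x ≁ y = ¬ x ~ y

  _~?_ : ∀ x y → Dec (x ~ y)
  x ~? y = T? (adj x y)

  ~-sym : ∀ {x y} → x ~ y → y ~ x
  ~-sym {x} {y} = subst T (symmetric x y)

  ~-irrefl : ∀ {x} → x ≁ x
  ~-irrefl {x} = subst T (irreflexive x)

  ~⇒≢ : ∀ {x y} → x ~ y → x ≢ y
  ~⇒≢ x~y refl = ~-irrefl x~y

  ~⇒∈neighbourhood : ∀ {v w} → v ~ w → w ∈ neighbourhood adj v
  ~⇒∈neighbourhood {v} {w} v~w =
    lookup⇒[]= w _ (trans (lookup∘tabulate (adj v) w) (Equivalence.to T-≡ v~w))

  -- `c ≡ d` is allowed, so that a single dominating vertex counts as a pair.
  record DominatesAllBut (v c d : Fin n) : Set where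
    field
      c≢v    : c ≢ v
      d≢v    : d ≢ v
      c≁v    : c ≁ v
      d≁v    : d ≁ v
      joined : c ≡ d ⊎ c ~ d
      covers : ∀ z → z ≢ v → (z ≡ c ⊎ z ≡ d) ⊎ (c ~ z ⊎ d ~ z)

  -- The pair {u, y} supplied by the edge-criticality of the non-edge uw.
  Arc : Fin n → Fin n → Set
  Arc u w = ∃ λ y → u ~ y × DominatesAllBut w u y

  -- Pairs obtained from criticality.

  module NoSmallCDS (3≤ : ∀ D → IsCDS adj D → 3 ≤ ∣ D ∣) where

    -- Otherwise `D` would dominate `v` too, giving a connected dominating set of G with fewer than
    -- three vertices.
    near-CDS-misses : ∀ {v D} → IsCDSIn adj (Minus v) D → ∣ D ∣ < 3 → ∀ d → d ∈ D → d ≁ v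
    near-CDS-misses {v} {D} (_ , dom , conn) ∣D∣<3 d d∈D d~v =
      <⇒≱ ∣D∣<3 (3≤ D ((λ _ _ → tt) , (λ w _ → dom′ w) , conn))
      where
      dom′ : ∀ w → w ∈ D ⊎ (∃ λ u → u ∈ D × u ~ w)
      dom′ w with w ≟ v
      ... | yes refl = inj₂ (d , d∈D , d~v)
      ... | no  w≢v  = dom w w≢v

    -- `D` is either `c` alone, and then `d` is `c`, or `c` and one other vertex, adjacent to `c` by
    -- connectedness.
    small-near-CDS : ∀ {v D c} → IsCDSIn adj (Minus v) D → ∣ D ∣ < 3 → c ∈ D →
      ∃ λ d → DominatesAllBut v c d
    small-near-CDS {v} {D} {c} cds@(sub , dom , conn) ∣D∣<3 c∈D
      with any? (λ d → (d ∈? D) ×-dec ¬? (d ≟ c))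
    ... | no none = c , record
      { c≢v = sub c c∈D ; d≢v = sub c c∈D ; c≁v = c≁v ; d≁v = c≁v
      ; joined = inj₁ refl ; covers = covers′ }
      where
      c≁v = near-CDS-misses cds ∣D∣<3 c c∈D
      only-c : ∀ {z} → z ∈ D → z ≡ c
      only-c {z} z∈D = decidable-stable (z ≟ c) (λ z≢c → none (z , z∈D , z≢c))
      covers′ : ∀ z → z ≢ v → (z ≡ c ⊎ z ≡ c) ⊎ (c ~ z ⊎ c ~ z)
      covers′ z z≢v with dom z z≢v
      ... | inj₁ z∈D = inj₁ (inj₁ (only-c z∈D))
      ... | inj₂ (u , u∈D , u~z) = inj₂ (inj₁ (subst (_~ z) (only-c u∈D) u~z))
    ... | yes (d , d∈D , d≢c) = d , record
      { c≢v = sub c c∈D ; d≢v = sub d d∈D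
      ; c≁v = near-CDS-misses cds ∣D∣<3 c c∈D ; d≁v = near-CDS-misses cds ∣D∣<3 d d∈D
      ; joined = inj₂ (first-step (conn c d c∈D d∈D)) ; covers = covers′ }
      where
      c-or-d : ∀ {z} → z ∈ D → z ≡ c ⊎ z ≡ d
      c-or-d {z} z∈D with z ≟ c | z ≟ d
      ... | yes z≡c | _       = inj₁ z≡c
      ... | no  _   | yes z≡d = inj₂ z≡d
      ... | no  z≢c | no  z≢d =
        contradiction (three-members⇒3≤∣p∣ c∈D d∈D z∈D d≢c z≢c z≢d) (<⇒≱ ∣D∣<3)
      first-step : Walk adj (_∈ D) c d → c ~ d
      first-step (nil _) = contradiction refl d≢c
      first-step (cons _ e w) with c-or-d (walk-start w)
      ... | inj₁ refl = first-step w
      ... | inj₂ refl = e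
      covers′ : ∀ z → z ≢ v → (z ≡ c ⊎ z ≡ d) ⊎ (c ~ z ⊎ d ~ z)
      covers′ z z≢v with dom z z≢v
      ... | inj₁ z∈D = inj₁ (c-or-d z∈D)
      ... | inj₂ (u , u∈D , u~z) with c-or-d u∈D
      ...   | inj₁ refl = inj₂ (inj₁ u~z)
      ...   | inj₂ refl = inj₂ (inj₂ u~z)

    -- As `w` is outside `D`, the new edge does not lie inside `D` and helps to dominate at most
    -- `w`; so `D` serves G - w with the old edges. The vertex `t`, missed by `u`, rules out the
    -- pair `u`, `u`. `adj′` is abstract to serve both orders of `u` and `w`.
    half-arc : (adj′ : Adjacency n) → ∀ {u w t D} →
      (∀ {x y} → T (adj′ x y) → x ~ y ⊎ (x ≡ u × y ≡ w) ⊎ (x ≡ w × y ≡ u)) →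
      u ≢ w → t ≢ u → t ≢ w → u ≁ t →
      IsCDS adj′ D → ∣ D ∣ < 3 → u ∈ D → w ∉ D → Arc u w
    half-arc adj′ {u} {w} {t} {D} split u≢w t≢u t≢w u≁t (_ , dom , conn) ∣D∣<3 u∈D w∉D =
      finish (small-near-CDS cds ∣D∣<3 u∈D)
      where
      ∈D⇒≢w : ∀ {x} → x ∈ D → x ≢ w
      ∈D⇒≢w x∈D refl = w∉D x∈D
      old : ∀ {x y} → x ∈ D → y ≢ w → T (adj′ x y) → x ~ y
      old x∈D y≢w e with split e
      ... | inj₁ x~y            = x~y
      ... | inj₂ (inj₁ (_ , q)) = contradiction q y≢w
      ... | inj₂ (inj₂ (q , _)) = contradiction q (∈D⇒≢w x∈D)
      cds : IsCDSIn adj (Minus w) D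
      cds = (λ _ → ∈D⇒≢w)
          , (λ z z≢w → case dom z tt of λ
              { (inj₁ z∈D) → inj₁ z∈D
              ; (inj₂ (x , x∈D , e)) → inj₂ (x , x∈D , old x∈D z≢w e) })
          , λ x y x∈D y∈D → walk-map (λ p q → old p (∈D⇒≢w q)) (conn x y x∈D y∈D)
      finish : ∃ (DominatesAllBut w u) → Arc u w
      finish (y , dab) with DominatesAllBut.joined dab
      ... | inj₂ u~y = y , u~y , dab
      ... | inj₁ refl with DominatesAllBut.covers dab t t≢w
      ...   | inj₁ (inj₁ t≡u) = contradiction t≡u t≢u
      ...   | inj₁ (inj₂ t≡u) = contradiction t≡u t≢u
      ...   | inj₂ (inj₁ u~t) = contradiction u~t u≁t
      ...   | inj₂ (inj₂ u~t) = contradiction u~t u≁t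

    arc-between : EdgeCritical adj 3 → ∀ {u w t} → u ≢ w → t ≢ u → t ≢ w →
      adj u w ≡ false → u ≁ t → w ≁ t → Arc u w ⊎ Arc w u
    arc-between (_ , crit) {u} {w} {t} u≢w t≢u t≢w uw u≁t w≁t with crit u w u≢w uw
    ... | D , cds@(_ , dom , conn) , ∣D∣<3 with u ∈? D | w ∈? D
    ...   | yes u∈D | no w∉D =
      inj₁ (half-arc (addEdge adj u w) (addEdge⁻ adj u w) u≢w t≢u t≢w u≁t cds ∣D∣<3 u∈D w∉D)
    ...   | no u∉D | yes w∈D =
      inj₂ (half-arc (addEdge adj u w) (swap ∘ addEdge⁻ adj u w)
        (u≢w ∘ sym) t≢w t≢u w≁t cds ∣D∣<3 w∈D u∉D)
      where
      swap : ∀ {x y} → x ~ y ⊎ (x ≡ u × y ≡ w) ⊎ (x ≡ w × y ≡ u) →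
        x ~ y ⊎ (x ≡ w × y ≡ u) ⊎ (x ≡ u × y ≡ w)
      swap (inj₁ e)        = inj₁ e
      swap (inj₂ (inj₁ e)) = inj₂ (inj₂ e)
      swap (inj₂ (inj₂ e)) = inj₂ (inj₁ e)
    -- `D` would be just `u` and `w`, but neither dominates `t`.
    ...   | yes u∈D | yes w∈D = contradiction ∣D∣<3 too-big
      where
      too-big : ¬ ∣ D ∣ < 3
      too-big ∣D∣<3 with dom t tt
      ... | inj₁ t∈D = <⇒≱ ∣D∣<3 (three-members⇒3≤∣p∣ u∈D w∈D t∈D (u≢w ∘ sym) t≢u t≢w)
      ... | inj₂ (x , x∈D , e) with addEdge⁻ adj u w e
      ...   | inj₂ (inj₁ (_ , t≡w)) = t≢w t≡w
      ...   | inj₂ (inj₂ (_ , t≡u)) = t≢u t≡u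
      ...   | inj₁ x~t = <⇒≱ ∣D∣<3 (three-members⇒3≤∣p∣ u∈D w∈D x∈D (u≢w ∘ sym)
                (λ { refl → u≁t x~t }) (λ { refl → w≁t x~t }))
    -- The new edge has no end in `D`, so `D` would already serve G.
    ...   | no u∉D | no w∉D = contradiction (3≤ D cds′) (<⇒≱ ∣D∣<3)
      where
      old : ∀ {x y} → x ∈ D → T (addEdge adj u w x y) → x ~ y
      old x∈D e with addEdge⁻ adj u w e
      ... | inj₁ x~y               = x~y
      ... | inj₂ (inj₁ (refl , _)) = contradiction x∈D u∉D
      ... | inj₂ (inj₂ (refl , _)) = contradiction x∈D w∉D
      cds′ : IsCDS adj D
      cds′ = (λ _ _ → tt)
           , (λ z _ → case dom z tt of λ
               { (inj₁ z∈D) → inj₁ z∈D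
               ; (inj₂ (x , x∈D , e)) → inj₂ (x , x∈D , old x∈D e) })
           , λ x y x∈D y∈D → walk-map (λ p _ → old p) (conn x y x∈D y∈D)

    -- Starting from `w` itself or from its dominator puts the vertex that takes care of `w` first.
    pair-dominating : VertexCritical adj 3 → ∀ {v w} → w ≢ v →
      ∃₂ λ c d → (w ≡ c ⊎ c ~ w) × DominatesAllBut v c d
    pair-dominating (_ , _ , crit) {v} {w} w≢v with crit v
    ... | D , cds@(_ , dom , _) , ∣D∣<3 with dom w w≢v
    ...   | inj₁ w∈D =
      let d , dab = small-near-CDS cds ∣D∣<3 w∈D in w , d , inj₁ refl , dab
    ...   | inj₂ (c , c∈D , c~w) =
      let d , dab = small-near-CDS cds ∣D∣<3 c∈D in c , d , inj₂ c~w , dab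

    -- Representatives of the members of an independent set.

    module AtVertex (edgeCrit : EdgeCritical adj 3) (vertexCrit : VertexCritical adj 3)
      (I : Subset n) (independent : IsIndependent adj I) (3≤∣I∣ : 3 ≤ ∣ I ∣) (v : Fin n) where

      apart : ∀ {x y} → x ∈ I → y ∈ I → x ≁ y
      apart {x} {y} x∈I y∈I = subst T (independent x y x∈I y∈I)

      arcs : ∀ {b b′} → b ∈ I → b′ ∈ I → b ≢ b′ → Arc b b′ ⊎ Arc b′ b
      arcs {b} {b′} b∈I b′∈I b≢b′ with third-member 3≤∣I∣ b b′
      ... | t , t∈I , t≢b , t≢b′ = arc-between edgeCrit b≢b′ t≢b t≢b′
        (independent b b′ b∈I b′∈I) (apart b∈I t∈I) (apart b′∈I t∈I)

      -- Among the members of I, the neighbour y of v misses exactly b.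
      Hits : Fin n → Fin n → Set
      Hits b y = v ~ y × y ≁ b × (∀ x → x ∈ I → x ≢ b → y ~ x)

      Represents : Fin n → Fin n → Set
      Represents y x = (v ~ x × y ≡ x) ⊎ (v ≁ x × Hits x y)

      Hits? : ∀ b y → Dec (Hits b y)
      Hits? b y = (v ~? y) ×-dec (¬? (y ~? b) ×-dec
        all? (λ x → (x ∈? I) →-dec (¬? (x ≟ b) →-dec (y ~? x))))

      Represents? : ∀ y x → Dec (Represents y x)
      Represents? y x = ((v ~? x) ×-dec (y ≟ x)) ⊎-dec (¬? (v ~? x) ×-dec Hits? x y)

      Represented : Fin n → Set
      Represented x = ∃ λ y → Represents y x

      Hits⇒≢v : ∀ {b y} → Hits b y → b ≢ v
      Hits⇒≢v (v~y , y≁b , _) refl = y≁b (~-sym v~y)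

      represents⇒~ : ∀ {x y} → Represents y x → v ~ y
      represents⇒~ (inj₁ (v~x , refl))    = v~x
      represents⇒~ (inj₂ (_ , v~y , _)) = v~y

      hitter-not-member : ∀ {b y} → v ≁ b → Hits b y → y ∉ I
      hitter-not-member v≁b (v~y , y≁b , all) y∈I =
        ~-irrefl (all _ y∈I (λ { refl → v≁b v~y }))

      -- A member of `I` represents only itself, a vertex outside `I` only the one member that it
      -- misses.
      represents-injective : ∀ {x x′ y} → x ∈ I → x′ ∈ I →
        Represents y x → Represents y x′ → x ≡ x′
      represents-injective _ _ (inj₁ (_ , refl)) (inj₁ (_ , refl)) = refl
      represents-injective x∈I _ (inj₁ (_ , refl)) (inj₂ (v≁x′ , h)) =
        contradiction x∈I (hitter-not-member v≁x′ h)
      represents-injective _ x′∈I (inj₂ (v≁x , h)) (inj₁ (_ , refl)) =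
        contradiction x′∈I (hitter-not-member v≁x h)
      represents-injective {x} {x′} _ x′∈I (inj₂ (_ , _ , _ , all)) (inj₂ (_ , _ , y≁x′ , _)) =
        decidable-stable (x ≟ x′) (λ x≢x′ → y≁x′ (all x′ x′∈I (x≢x′ ∘ sym)))

      -- `b` is adjacent neither to `v` nor to any member of `I`, so dominating `v` and the members
      -- other than `b` and `b′` is left to `y`.
      arc⇒Hits : ∀ {b b′ y} → b ∈ I → b ≢ v → b′ ≢ v → v ≁ b →
        b ~ y → DominatesAllBut b′ b y → Hits b′ y
      arc⇒Hits {b} {b′} {y} b∈I b≢v b′≢v v≁b b~y dab = v~y , d≁v , all
        where
        open DominatesAllBut dab
        v~y : v ~ y
        v~y with covers v (b′≢v ∘ sym)
        ... | inj₁ (inj₁ v≡b)  = contradiction (sym v≡b) b≢v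
        ... | inj₁ (inj₂ refl) = contradiction (~-sym b~y) v≁b
        ... | inj₂ (inj₁ b~v)  = contradiction (~-sym b~v) v≁b
        ... | inj₂ (inj₂ y~v)  = ~-sym y~v
        all : ∀ x → x ∈ I → x ≢ b′ → y ~ x
        all x x∈I x≢b′ with covers x x≢b′
        ... | inj₁ (inj₁ refl) = ~-sym b~y
        ... | inj₁ (inj₂ refl) = contradiction b~y (apart b∈I x∈I)
        ... | inj₂ (inj₁ b~x)  = contradiction b~x (apart b∈I x∈I)
        ... | inj₂ (inj₂ y~x)  = y~x

      -- Both vertices of a pair dominating G - u miss `u`. If the one taking care of `v` is `v`
      -- itself, the other is a neighbour of `v`, since `v` alone does not dominate `x`.
      neighbour-missing : ∀ {u x} → u ≢ v → x ≢ u → x ≢ v → v ≁ x →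
        ∃ λ c → v ~ c × c ≁ u × c ≢ u
      neighbour-missing {u} {x} u≢v x≢u x≢v v≁x
        with pair-dominating vertexCrit (u≢v ∘ sym)
      ... | c , d , inj₂ c~v , dab = c , ~-sym c~v , DominatesAllBut.c≁v dab , DominatesAllBut.c≢v dab
      ... | c , d , inj₁ refl , dab = d , v~d joined , d≁v , d≢v
        where
        open DominatesAllBut dab
        v~d : v ≡ d ⊎ v ~ d → v ~ d
        v~d (inj₂ e)    = e
        v~d (inj₁ refl) with covers x x≢u
        ... | inj₁ (inj₁ x≡v) = contradiction x≡v x≢v
        ... | inj₁ (inj₂ x≡v) = contradiction x≡v x≢v
        ... | inj₂ (inj₁ v~x) = contradiction v~x v≁x
        ... | inj₂ (inj₂ v~x) = contradiction v~x v≁x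

      -- c can be given up as a representative: everyone represented keeps one different from c.
      Avoidable : Fin n → Set
      Avoidable c = ∀ {x} → x ∈ I → Represented x → ∃ λ y → Represents y x × y ≢ c

      second-hitter-avoidable : ∀ {b z c} → b ∈ I → v ≁ b → Hits b z → Hits b c → z ≢ c → Avoidable c
      second-hitter-avoidable {b} {z} {c} b∈I v≁b hz hc z≢c x∈I (y , r) with y ≟ c
      ... | no y≢c = y , r , y≢c
      ... | yes refl with represents-injective x∈I b∈I r (inj₂ (v≁b , hc))
      ...   | refl = z , inj₂ (v≁b , hz) , z≢c

      -- The alternative recorded about `c` will tell it apart from a second spare neighbour, which
      -- is adjacent to `y` and hits no member.
      surplus : ∀ {b y} → b ∈ I → v ≁ b → Hits b y →
        ∃ λ c → v ~ c × (c ≁ y ⊎ (∃ λ b₀ → b₀ ∈ I × Hits b₀ c)) × Avoidable c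
      surplus {b} {y} b∈I v≁b hy@(v~y , y≁b , y~rest)
        with neighbour-missing (~⇒≢ v~y ∘ sym) (λ { refl → v≁b v~y }) (Hits⇒≢v hy) v≁b
      ... | c , v~c , c≁y , c≢y
        with any? (λ b₀ → (b₀ ∈? I) ×-dec (¬? (v ~? b₀) ×-dec Hits? b₀ c))
      ...   | no none = c , v~c , inj₁ c≁y , λ { x∈I (y′ , r) → y′ , r , λ { refl → unrepresenting x∈I r } }
        where
        unrepresenting : ∀ {x} → x ∈ I → ¬ Represents c x
        -- Here `c` is a member other than `b`, hence adjacent to `y`.
        unrepresenting c∈I (inj₁ (_ , refl)) =
          c≁y (~-sym (y~rest c c∈I (λ { refl → v≁b v~c })))
        unrepresenting x∈I (inj₂ (v≁x , h)) = none (_ , x∈I , v≁x , h)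
      ...   | yes (b₀ , b₀∈I , v≁b₀ , hc@(_ , c≁b₀ , _)) with b₀ ≟ b
      ...     | yes refl = c , v~c , inj₂ (b , b∈I , hc) ,
        second-hitter-avoidable b∈I v≁b hy hc (c≢y ∘ sym)
      ...     | no b₀≢b with arcs b∈I b₀∈I (b₀≢b ∘ sym)
      ...       | inj₁ (y′ , b~y′ , dab) = c , v~c , inj₂ (b₀ , b₀∈I , hc) ,
        second-hitter-avoidable b₀∈I v≁b₀
          (arc⇒Hits b∈I (Hits⇒≢v hy) (Hits⇒≢v hc) v≁b b~y′ dab) hc y′≢c
        where
        open DominatesAllBut dab
        y′≢c : y′ ≢ c
        y′≢c refl with covers y (λ { refl → v≁b₀ v~y })
        ... | inj₁ (inj₁ refl) = v≁b v~y
        ... | inj₁ (inj₂ refl) = c≢y refl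
        ... | inj₂ (inj₁ b~y)  = y≁b (~-sym b~y)
        ... | inj₂ (inj₂ c~y)  = c≁y c~y
      ...       | inj₂ (y′ , b₀~y′ , dab) = y , v~y , inj₂ (b , b∈I , hy) ,
        second-hitter-avoidable b∈I v≁b
          (arc⇒Hits b₀∈I (Hits⇒≢v hc) (Hits⇒≢v hy) v≁b₀ b₀~y′ dab) hy y′≢y
        where
        open DominatesAllBut dab
        y′≢y : y′ ≢ y
        y′≢y refl with covers c (λ { refl → v≁b v~c })
        ... | inj₁ (inj₁ refl) = v≁b₀ v~c
        ... | inj₁ (inj₂ refl) = c≢y refl
        ... | inj₂ (inj₁ b₀~c) = c≁b₀ (~-sym b₀~c)
        ... | inj₂ (inj₂ y~c)  = c≁y (~-sym y~c)

      -- The remaining case, in which s is the only member of I not adjacent to v ∉ I, so that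
      -- there is no y to which the argument of surplus could be applied.
      lone-nonneighbour : ∀ {s} → s ∈ I → v ∉ I → v ≁ s → (∀ {x} → x ∈ I → x ≢ s → v ~ x) →
        ∃ λ c → v ~ c × c ∉ I
      lone-nonneighbour {s} s∈I v∉I v≁s v~rest with any? (λ c → (v ~? c) ×-dec ¬? (c ∈? I))
      ... | yes found = found
      ... | no none with third-member 3≤∣I∣ s s
      -- If all neighbours of `v` lay in `I`, no arc could run either way between `s` and another
      -- member `a`.
      ...   | a , a∈I , a≢s , _ = contradiction (arcs s∈I a∈I (a≢s ∘ sym)) no-arcs
        where
        v~a : v ~ a
        v~a = v~rest a∈I a≢s
        ∈I⇒≢v : ∀ {x} → x ∈ I → x ≢ v
        ∈I⇒≢v x∈I refl = v∉I x∈I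
        neighbour∈I : ∀ {c} → v ~ c → c ∈ I
        neighbour∈I {c} v~c = decidable-stable (c ∈? I) (λ c∉I → none (c , v~c , c∉I))

        -- In a pair dominating G - a, the vertex `c` next to `v` lies in `I` and misses `s`, so `d`
        -- is adjacent to `s`. Then `d` is neither `a` nor `v` and is adjacent to neither of them,
        -- so they leave it undominated.
        no-a→s-via-v : ¬ DominatesAllBut s a v
        no-a→s-via-v sav with pair-dominating vertexCrit (∈I⇒≢v a∈I ∘ sym)
        ... | c , d , inj₁ refl , cd = DominatesAllBut.c≁v cd v~a
        ... | c , d , inj₂ c~v , cd = d-unreached (DominatesAllBut.covers sav d (~⇒≢ d~s))
          where
          c∈I = neighbour∈I (~-sym c~v)
          d~s : d ~ s
          d~s with DominatesAllBut.covers cd s (a≢s ∘ sym)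
          ... | inj₁ (inj₁ refl) = contradiction (~-sym c~v) v≁s
          ... | inj₂ (inj₁ c~s)  = contradiction c~s (apart c∈I s∈I)
          ... | inj₂ (inj₂ d~s)  = d~s
          ... | inj₁ (inj₂ refl) with DominatesAllBut.joined cd
          ...   | inj₁ refl = contradiction (~-sym c~v) v≁s
          ...   | inj₂ c~s  = contradiction c~s (apart c∈I s∈I)
          d-unreached : ¬ ((d ≡ a ⊎ d ≡ v) ⊎ (a ~ d ⊎ v ~ d))
          d-unreached (inj₁ (inj₁ refl)) = apart a∈I s∈I d~s
          d-unreached (inj₁ (inj₂ refl)) = v≁s d~s
          d-unreached (inj₂ (inj₁ a~d))  = DominatesAllBut.d≁v cd (~-sym a~d)
          d-unreached (inj₂ (inj₂ v~d))  = apart (neighbour∈I v~d) s∈I d~s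

        -- For `z` other than `v`, a neighbour `c` of `v` missing `z` lies in `I` and is not `a`, so
        -- neither `a` nor `z` dominates it.
        no-a→s : ∀ {z} → a ~ z → ¬ DominatesAllBut s a z
        no-a→s {z} a~z saz with z ≟ v
        ... | yes refl = no-a→s-via-v saz
        ... | no z≢v with neighbour-missing z≢v (DominatesAllBut.d≢v saz ∘ sym) (∈I⇒≢v s∈I) v≁s
        ...   | c , v~c , c≁z , c≢z
          with DominatesAllBut.covers saz c (λ { refl → v≁s v~c })
        ...     | inj₁ (inj₁ refl) = c≁z a~z
        ...     | inj₁ (inj₂ c≡z)  = c≢z c≡z
        ...     | inj₂ (inj₁ a~c)  = apart a∈I (neighbour∈I v~c) a~c
        ...     | inj₂ (inj₂ z~c)  = c≁z (~-sym z~c)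

        no-arcs : ¬ (Arc s a ⊎ Arc a s)
        no-arcs (inj₁ (y , s~y , asy)) = apart s∈I (neighbour∈I v~y) s~y
          where v~y = proj₁ (arc⇒Hits s∈I (∈I⇒≢v s∈I) (∈I⇒≢v a∈I) v≁s s~y asy)
        no-arcs (inj₂ (z , a~z , saz)) = no-a→s a~z saz

      -- Counting representatives against the degree.

      ∣I∣≤degree : ∣ I ∣ ≤ degree adj v
      ∣I∣≤degree = by-cases (v ∈? I)
        (any? (λ s → (s ∈? I) ×-dec (¬? (s ≟ v) ×-dec ¬? (any? (λ y → Represents? y s)))))
        where
        Unrepresented : Fin n → Set
        Unrepresented s = s ∈ I × s ≢ v × ¬ Represented s

        one-exception : ∀ s c → v ~ c → (∀ {x} → x ∈ I → x ≢ s → ∃ λ y → Represents y x × y ≢ c) →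
          ∣ I ∣ ≤ degree adj v
        one-exception s c v~c rep = injection-with-spare (λ x y → Represents y x) I _ s c
          (~⇒∈neighbourhood v~c)
          (λ x x∈I x≢s → let y , r , y≢c = rep x∈I x≢s in
            y , ~⇒∈neighbourhood (represents⇒~ r) , r , y≢c)
          represents-injective

        module Unrep {s} (s∈I : s ∈ I) (s≢v : s ≢ v) (unrep : ¬ Represented s) where
          v≁s : v ≁ s
          v≁s v~s = unrep (s , inj₁ (v~s , refl))

          -- An arc from `x` to `s` would give `s` a representative, so the arc runs from `s` and
          -- gives one to `x`.
          arc-from-s : ∀ {x} → x ∈ I → x ≢ s → x ≢ v → v ≁ x →
            ∃ λ y → s ~ y × DominatesAllBut x s y × Hits x y
          arc-from-s x∈I x≢s x≢v v≁x with arcs s∈I x∈I (x≢s ∘ sym)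
          ... | inj₁ (y , s~y , dab) = y , s~y , dab , arc⇒Hits s∈I s≢v x≢v v≁s s~y dab
          ... | inj₂ (y , x~y , dab) =
            contradiction (y , inj₂ (v≁s , arc⇒Hits x∈I x≢v s≢v v≁x x~y dab)) unrep

          represented : ∀ {x} → x ∈ I → x ≢ s → x ≢ v → Represented x
          represented {x} x∈I x≢s x≢v with v ~? x
          ... | yes v~x = x , inj₁ (v~x , refl)
          ... | no v≁x = let y , _ , _ , h = arc-from-s x∈I x≢s x≢v v≁x in y , inj₂ (v≁x , h)

        by-cases : Dec (v ∈ I) → Dec (∃ Unrepresented) → ∣ I ∣ ≤ degree adj v
        by-cases v∈?I (no none) = all-represented v∈?I
          where
          represented : ∀ {x} → x ∈ I → x ≢ v → Represented x
          represented {x} x∈I x≢v = decidable-stable (any? (λ y → Represents? y x))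
            (λ ¬r → none (x , x∈I , x≢v , ¬r))

          all-represented : Dec (v ∈ I) → ∣ I ∣ ≤ degree adj v
          all-represented (no v∉I) = injection⇒∣p∣≤∣q∣ (λ x y → Represents y x) I _
            (λ x x∈I → let y , r = represented x∈I (λ { refl → v∉I x∈I }) in
              y , ~⇒∈neighbourhood (represents⇒~ r) , r)
            represents-injective
          all-represented (yes v∈I) with third-member 3≤∣I∣ v v
          -- `v` cannot have a representative, so it takes the spare neighbour.
          ... | x , x∈I , x≢v , _ with represented x∈I x≢v
          ...   | y , inj₁ (v~x , _) = contradiction v~x (apart v∈I x∈I)
          ...   | y , inj₂ (v≁x , h) with surplus x∈I v≁x h
          ...     | c , v~c , _ , avoid =
            one-exception v c v~c (λ x∈I x≢v → avoid x∈I (represented x∈I x≢v))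

        by-cases (no v∉I) (yes (s , s∈I , s≢v , unrep))
          with any? (λ x → (x ∈? I) ×-dec (¬? (x ≟ s) ×-dec ¬? (v ~? x)))
        ... | yes (x , x∈I , x≢s , v≁x) =
          let y , _ , _ , h = arc-from-s x∈I x≢s (∈I⇒≢v x∈I) v≁x
              c , v~c , _ , avoid = surplus x∈I v≁x h
          in one-exception s c v~c (λ x∈I x≢s → avoid x∈I (represented x∈I x≢s (∈I⇒≢v x∈I)))
          where
          open Unrep s∈I s≢v unrep
          ∈I⇒≢v : ∀ {x} → x ∈ I → x ≢ v
          ∈I⇒≢v x∈I refl = v∉I x∈I
        -- All members but `s` represent themselves, so a neighbour of `v` outside `I` is free for
        -- `s`.
        ... | no none =
          let c , v~c , c∉I = lone-nonneighbour s∈I v∉I v≁s v~rest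
          in one-exception s c v~c (λ x∈I x≢s →
               _ , inj₁ (v~rest x∈I x≢s , refl) , λ { refl → c∉I x∈I })
          where
          open Unrep s∈I s≢v unrep
          v~rest : ∀ {x} → x ∈ I → x ≢ s → v ~ x
          v~rest {x} x∈I x≢s = decidable-stable (v ~? x) (λ v≁x → none (x , x∈I , x≢s , v≁x))

        by-cases (yes v∈I) (yes (s , s∈I , s≢v , unrep)) with third-member 3≤∣I∣ v s
        ... | x , x∈I , x≢v , x≢s = two-exceptions
          (neighbour-missing s≢v x≢s x≢v v≁x) (arc-from-s x∈I x≢s x≢v v≁x)
          where
          open Unrep s∈I s≢v unrep
          v≁x = apart v∈I x∈I

          -- `t` goes to `v` and `c` to `s`. As `t` misses `s`, it could hit only `s`, which is
          -- unrepresented.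
          two-exceptions : (∃ λ t → v ~ t × t ≁ s × t ≢ s) →
            (∃ λ y → s ~ y × DominatesAllBut x s y × Hits x y) → ∣ I ∣ ≤ degree adj v
          two-exceptions (t , v~t , t≁s , _) (y , s~y , dab , h) with surplus x∈I v≁x h
          ... | c , v~c , origin , avoid =
            injection-with-spare R I _ s c (~⇒∈neighbourhood v~c) total inj
            where
            R : Fin n → Fin n → Set
            R x′ y′ = (x′ ≡ v × y′ ≡ t) ⊎ Represents y′ x′

            t-hits-nothing : ∀ {b} → b ∈ I → ¬ Hits b t
            t-hits-nothing {b} b∈I h′@(_ , _ , all) with s ≟ b
            ... | yes refl = unrep (t , inj₂ (v≁s , h′))
            ... | no s≢b   = t≁s (all s s∈I s≢b)

            t-represents-nothing : ∀ {x′} → x′ ∈ I → ¬ Represents t x′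
            t-represents-nothing x′∈I (inj₁ (v~x′ , _)) = apart v∈I x′∈I v~x′
            t-represents-nothing x′∈I (inj₂ (_ , h′))   = t-hits-nothing x′∈I h′

            y~t : y ~ t
            y~t with DominatesAllBut.covers dab t (λ { refl → v≁x v~t })
            ... | inj₁ (inj₁ refl) = contradiction v~t v≁s
            ... | inj₁ (inj₂ refl) = contradiction (~-sym s~y) t≁s
            ... | inj₂ (inj₁ s~t)  = contradiction (~-sym s~t) t≁s
            ... | inj₂ (inj₂ y~t)  = y~t

            -- `c` either misses `y`, which `t` does not, or hits a member, which `t` does not.
            t≢c : ∀ {c} → c ≁ y ⊎ (∃ λ b₀ → b₀ ∈ I × Hits b₀ c) → t ≢ c
            t≢c (inj₁ c≁y) refl              = c≁y (~-sym y~t)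
            t≢c (inj₂ (_ , b₀∈I , h₀)) refl = t-hits-nothing b₀∈I h₀

            total : ∀ x′ → x′ ∈ I → x′ ≢ s → ∃ λ y′ → y′ ∈ neighbourhood adj v × R x′ y′ × y′ ≢ c
            total x′ x′∈I x′≢s with x′ ≟ v
            ... | yes x′≡v = t , ~⇒∈neighbourhood v~t , inj₁ (x′≡v , refl) , t≢c origin
            ... | no x′≢v with avoid x′∈I (represented x′∈I x′≢s x′≢v)
            ...   | y′ , r , y′≢c = y′ , ~⇒∈neighbourhood (represents⇒~ r) , inj₂ r , y′≢c

            inj : ∀ {x₁ x₂ y′} → x₁ ∈ I → x₂ ∈ I → R x₁ y′ → R x₂ y′ → x₁ ≡ x₂
            inj _ _ (inj₁ (refl , _)) (inj₁ (refl , _)) = refl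
            inj _ x₂∈I (inj₁ (_ , refl)) (inj₂ r)       = contradiction r (t-represents-nothing x₂∈I)
            inj x₁∈I _ (inj₂ r) (inj₁ (_ , refl))       = contradiction r (t-represents-nothing x₁∈I)
            inj x₁∈I x₂∈I (inj₂ r) (inj₂ r′)            = represents-injective x₁∈I x₂∈I r r′

    -- For a neighbour `w` of `v`, a pair dominating G - w misses `w`, so it omits `v` and must
    -- contain another neighbour of `v`.
    2≤degree : VertexCritical adj 3 → ∀ v → 2 ≤ degree adj v
    2≤degree vertexCrit@((3≤n , (_ , walk) , _) , _) v with some-neighbour 3≤n walk v
    ... | w , v~w with pair-dominating vertexCrit (~⇒≢ v~w)
    ...   | c , d , inj₁ refl , dab = contradiction v~w (DominatesAllBut.c≁v dab)
    ...   | c , d , inj₂ c~v , dab = two-members⇒2≤∣p∣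
      (~⇒∈neighbourhood v~w) (~⇒∈neighbourhood (~-sym c~v)) (DominatesAllBut.c≢v dab)

theorem3p3 : (n : ℕ) (adj : Adjacency n) → IsSimple adj → Connected adj →
    MaximalVertexCritical adj 3 →
    (α δ : ℕ) → IndependenceNumberIs adj α → MinDegreeIs adj δ → α ≤ δ
theorem3p3 n adj simple _ (edgeCrit , vertexCrit@(_ , (_ , 3≤) , _)) α δ
  ((I , independent , refl) , _) ((v , refl) , _) with 3 ≤? ∣ I ∣
... | yes 3≤∣I∣ = ∣I∣≤degree
  where
  open Graph adj simple
  open NoSmallCDS 3≤
  open AtVertex edgeCrit vertexCrit I independent 3≤∣I∣ v
... | no 3≰∣I∣ = ≤-trans (≤-pred (≰⇒> 3≰∣I∣)) (2≤degree vertexCrit v)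
  where
  open Graph adj simple
  open NoSmallCDS 3≤
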